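{- Let $\Sigma$ be a (possibly infinite) unranked signature, $\mathcal{X}$ an infinite set of variables disjoint from $\Sigma$, and $>$ a well-founded partial order on $\Sigma$. Let $\rightsquigarrow$ be the rewrite relation induced by the term rewrite system $\mathit{Star}$ on the terms $\mathcal{T}(\Sigma\cup\Sigma^\star,\mathcal{X})$. Then for no (star-free) term $t\in\mathcal{T}(\Sigma,\mathcal{X})$ do we have $t\mathrel{(\rightsquigarrow^+\cdot\simeq)}t$; that is, there are no $t\in\mathcal{T}(\Sigma,\mathcal{X})$ and term $t'$ with $t\rightsquigarrow^+t'$ and $t'\simeq t$.
   Context: Terms: for an unranked signature $\Gamma$ (a set of symbols without fixed arity) and a set $\mathcal{X}$ of variables disjoint from $\Gamma$, the set of terms $\mathcal{T}(\Gamma,\mathcal{X})$ is the smallest set containing $\mathcal{X}$ and containing $f(t_1,\ldots,t_n)$ for all $f\in\Gamma$, $n\ge 0$ and terms $t_1,\ldots,t_n$; the order of arguments matters. A term rewrite system is a set of rules $\ell\to r$; it induces on terms the rewrite relation $C[\sigma(\ell)]\to C[\sigma(r)]$ for all one-hole contexts $C$, rules $\ell\to r$ and substitutions $\sigma$. $\simeq$ is the equivalence relation on terms generated by swapping two adjacent arguments of a symbol anywhere inside a term, i.e. generated by the rewrite rules $f(\vec u,x,y,\vec w)\to f(\vec u,y,x,\vec w)$ for all symbols $f$. Starred signature: $\Sigma^\star=\{f^\star\mid f\in\Sigma\}$, a set of fresh symbols (disjoint from $\Sigma$). The system $\mathit{Star}$ over $\Sigma\cup\Sigma^\star$ consists of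 the following rules, for all $f,g\in\Sigma$, where $\vec x,\vec y,\vec z$ are finite (possibly empty) vectors of distinct variables: (put) $f(\vec x)\rightsquigarrow f^\star(\vec x)$; (select) $f^\star(\vec x,y,\vec z)\rightsquigarrow y$; (copy) $f^\star(\vec x)\rightsquigarrow g(f^\star(\vec x),\ldots,f^\star(\vec x))$ with $0$ or more copies of $f^\star(\vec x)$, if $f>g$; (down) $f^\star(\vec x,g(\vec y),\vec z)\rightsquigarrow f(\vec x,g^\star(\vec y),\ldots,g^\star(\vec y),\vec z)$ with $0$ or more copies of $g^\star(\vec y)$. -}

module Defs where

open import Data.List.Base using (List; []; _∷_; _++_; map; replicate)
open import Data.List.Membership.Propositional using (_∈_)
open import Data.List.Relation.Unary.Unique.Propositional using (Unique)
open import Data.Nat.Base using (ℕ)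
open import Data.Product.Base using (∃)
open import Level using (Level; _⊔_)
open import Relation.Binary.Construct.Closure.Equivalence using (EqClosure)
open import Relation.Binary.Core using (Rel)
open import Relation.Nullary.Negation.Core using (¬_)

private
  variable
    a b ℓ : Level

Infinite : Set a → Set a
Infinite A = ¬ (∃ λ (xs : List A) → ∀ x → x ∈ xs)

data Term (Γ : Set a) (X : Set b) : Set (a ⊔ b) where
  var : X → Term Γ X
  fun : Γ → List (Term Γ X) → Term Γ X

vars : {Γ : Set a} {X : Set b} → List X → List (Term Γ X)
vars = map var

module _ {Γ : Set a} {X : Set b} where

  mutual

    subst : (X → Term Γ X) → Term Γ X → Term Γ X
    subst σ (var x)    = σ x
    subst σ (fun f ts) = fun f (substs σ ts)

    substs : (X → Term Γ X) → List (Term Γ X) → List (Term Γ X)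
    substs σ []       = []
    substs σ (t ∷ ts) = subst σ t ∷ substs σ ts

data Context (Γ : Set a) (X : Set b) : Set (a ⊔ b) where
  hole : Context Γ X
  fun  : Γ → List (Term Γ X) → Context Γ X → List (Term Γ X) → Context Γ X

plug : {Γ : Set a} {X : Set b} → Context Γ X → Term Γ X → Term Γ X
plug hole            t = t
plug (fun f us C vs) t = fun f (us ++ plug C t ∷ vs)

-- A term rewrite system is a set of pairs of terms, that is, a binary
-- relation on terms.
TRS : Set a → Set b → (ℓ : Level) → Set _
TRS Γ X ℓ = Rel (Term Γ X) ℓ

data Rewrite {Γ : Set a} {X : Set b} (R : TRS Γ X ℓ) : Rel (Term Γ X) (a ⊔ b ⊔ ℓ) where
  step : ∀ (C : Context Γ X) (σ : X → Term Γ X) {l r} → R l r →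
         Rewrite R (plug C (subst σ l)) (plug C (subst σ r))

data Swap {Γ : Set a} {X : Set b} : TRS Γ X (a ⊔ b) where
  swap : ∀ f us x y ws → Unique (us ++ x ∷ y ∷ ws) →
         Swap (fun f (vars us ++ var x ∷ var y ∷ vars ws))
              (fun f (vars us ++ var y ∷ var x ∷ vars ws))

infix 4 _≃_

_≃_ : {Γ : Set a} {X : Set b} → Rel (Term Γ X) (a ⊔ b)
_≃_ = EqClosure (Rewrite Swap)

-- The disjoint union of a signature with its starred copy.
data WithStars (F : Set a) : Set a where
  plain   : F → WithStars F
  starred : F → WithStars F

module _ {F : Set a} {X : Set b} where

  mutual

    -- The inclusion of the star-free terms.
    embed : Term F X → Term (WithStars F) X
    embed (var x)    = var x
    embed (fun f ts) = fun (plain f) (embeds ts)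

    embeds : List (Term F X) → List (Term (WithStars F) X)
    embeds []       = []
    embeds (t ∷ ts) = embed t ∷ embeds ts

-- All variables on a left-hand side are pairwise distinct, across the
-- different vectors as well as within each of them.
data Star {F : Set a} {X : Set b} (_>_ : Rel F ℓ) : TRS (WithStars F) X (a ⊔ b ⊔ ℓ) where

  put    : ∀ f xs → Unique xs →
           Star _>_ (fun (plain f) (vars xs))
                    (fun (starred f) (vars xs))

  select : ∀ f xs y zs → Unique (xs ++ y ∷ zs) →
           Star _>_ (fun (starred f) (vars xs ++ var y ∷ vars zs))
                    (var y)

  copy   : ∀ f g xs (n : ℕ) → Unique xs → f > g →
           Star _>_ (fun (starred f) (vars xs))
                    (fun (plain g) (replicate n (fun (starred f) (vars xs))))

  down   : ∀ f g xs ys zs (n : ℕ) → Unique (xs ++ ys ++ zs) →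
           Star _>_ (fun (starred f) (vars xs ++ fun (plain g) (vars ys) ∷ vars zs))
                    (fun (plain f) (vars xs ++ replicate n (fun (starred g) (vars ys)) ++ vars zs))

module Submission where

-- Suppose t rewrites in finitely many steps to t' with t' equivalent to t.
-- The relation generated by the rules need not terminate on terms with stars
-- (copy lets a starred term reproduce itself), so there is in general no
-- descending measure on these terms. But a finite derivation uses each star only
-- finitely often, so every star can be equipped with a natural number, its
-- fuel, of which each use burns one unit: put introduces a star with any
-- amount of fuel, while select, copy and down need a head symbol with positive
-- fuel, and the starred heads that copy repeats and down creates get one unit
-- less. The proof has two halves.
--
-- Termination. The fuelled relation terminates, even modulo exchanging
-- arguments (◁-wellFounded). By structural induction it suffices that a term
-- whose arguments are accessible is accessible. This is shown
-- (plain-accessible, starred-accessible) by induction on, lexicographically,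
-- the head symbol f in the order >, the multiset of the arguments in the
-- multiset extension of the relation itself, and the label of f, a symbol
-- without star counting as having infinite fuel. Indeed select returns an
-- argument, put and copy leave behind f with less fuel, copy moreover wrapping
-- these terms in a smaller head symbol, while down, like any step inside an
-- argument, replaces one argument by finitely many of its own reducts. Lists
-- of accessible terms are accessible in the multiset extension
-- (MultisetExtension.accessible).
--
-- Simulation. A step between terms with stars can be followed by a fuelled
-- step if every star has at least k + 1 units of fuel, and in such a way that
-- afterwards every star has at least k (Star-simulated). So enough initial
-- fuel allows a derivation of any length to be followed (Star⁺-simulated).
-- Exchanges of arguments can be followed as well (≃-simulated). Since a
-- star-free term carries no fuel, it has just one fuelled counterpart
-- (embed-lift-unique), so the cycle through t yields a cycle of the
-- terminating relation.

open import Defs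
open import Data.List.Base using (List; []; _∷_; _++_; replicate)
open import Data.List.Relation.Binary.Pointwise as Pointwise using (Pointwise; []; _∷_)
open import Data.List.Relation.Unary.All as All using (All; []; _∷_)
import Data.List.Relation.Unary.All.Properties as All
import Data.List.Relation.Binary.Equality.Setoid as ListEquality
import Data.List.Relation.Binary.Permutation.Setoid as Permutation
import Data.List.Relation.Binary.Permutation.Setoid.Properties as PermutationProperties
open import Data.Nat.Base using (ℕ; zero; suc; _≤_; s≤s)
open import Data.Nat.Properties using (≤-refl; ≤-trans; n≤1+n)
open import Data.Product.Base using (∃; ∃₂; _×_; _,_)
open import Data.Sum.Base using (_⊎_; inj₁; inj₂)
open import Function.Base using (flip)
open import Induction.WellFounded using (WellFounded; Acc; acc; acc-inverse; wf⇒asym)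
open import Level using (Level; _⊔_)
open import Relation.Binary.Bundles using (Setoid)
open import Relation.Binary.Construct.Closure.Equivalence using (EqClosure; setoid)
open import Relation.Binary.Construct.Closure.ReflexiveTransitive using (ε; _◅_; _◅◅_)
open import Relation.Binary.Construct.Closure.Symmetric using (fwd; bwd)
open import Relation.Binary.Construct.Closure.Transitive as Trans
  using (TransClosure; [_]; _∷_; _∷ʳ_)
open import Relation.Binary.Core using (Rel; REL)
open import Relation.Binary.Definitions using (_Respectsʳ_)
open import Relation.Binary.PropositionalEquality.Core using (_≡_; refl; cong; cong₂)
open import Relation.Binary.Structures using (IsStrictPartialOrder)
open import Relation.Nullary.Negation.Core using (¬_; contradiction)

private
  variable
    a b r ℓ ℓ' : Level
    A B F : Set a
    X : Set b

-- The multiset extension of a relation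

-- Multisets over a setoid are lists up to permutation and the setoid equality.
module MultisetExtension (S : Setoid a ℓ) (_<_ : Rel (Setoid.Carrier S) ℓ')
                         (<-respʳ : _<_ Respectsʳ Setoid._≈_ S) where

  open Setoid S using (_≈_) renaming (Carrier to C; sym to ≈-sym)
  open ListEquality S using (_∷_)
  open Permutation S
    using (_↭_; ↭-refl; ↭-sym; ↭-trans; ↭-prep; ↭-swap; ↭-reflexive-≋; prep)
  open PermutationProperties S using (split; drop-∷; ++⁺ˡ; ↭-shift; shifts; ¬x∷xs↭[])

  -- A multiset decreases when one element y is replaced by finitely many
  -- elements ws below it. This is the one-step relation: it is not transitive.
  data _≺_ : Rel (List C) (a ⊔ ℓ ⊔ ℓ') where
    replace : ∀ {xs ys} y zs ws → ys ↭ y ∷ zs → xs ↭ ws ++ zs → All (_< y) ws → xs ≺ ys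

  ≺-respʳ-↭ : _≺_ Respectsʳ _↭_
  ≺-respʳ-↭ ys↭ys' (replace y zs ws ys↭ xs↭ ws<y) =
    replace y zs ws (↭-trans (↭-sym ys↭ys') ys↭) xs↭ ws<y

  Acc-resp-↭ : ∀ {xs ys} → xs ↭ ys → Acc _≺_ xs → Acc _≺_ ys
  Acc-resp-↭ xs↭ys (acc rs) = acc λ zs≺ys → rs (≺-respʳ-↭ (↭-sym xs↭ys) zs≺ys)

  replace-within : ∀ us {y} vs ws → All (_< y) ws → (us ++ ws ++ vs) ≺ (us ++ y ∷ vs)
  replace-within us {y} vs ws ws<y = replace y (us ++ vs) ws (↭-shift us vs) (shifts us ws) ws<y

  -- Either the two heads are matched with each other, or each of them occurs
  -- in the tail of the other list.
  ∷-↭-∷ : ∀ {x y xs zs} → x ∷ xs ↭ y ∷ zs →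
          (x ≈ y × xs ↭ zs) ⊎ ∃ λ ws → xs ↭ y ∷ ws × zs ↭ x ∷ ws
  ∷-↭-∷ {x} {y} {xs} {zs} p with split y [] zs p
  ... | []     , qs , x≈y ∷ _ = inj₁ (x≈y , drop-∷ (↭-trans p (prep (≈-sym x≈y) ↭-refl)))
  ... | u ∷ us , qs , x≈u ∷ xs≋ = inj₂ (us ++ qs , xs↭ ,
      drop-∷ (↭-trans (↭-sym p) (↭-trans (↭-prep x xs↭) (↭-swap x y ↭-refl))))
    where
    xs↭ : xs ↭ y ∷ us ++ qs
    xs↭ = ↭-trans (↭-reflexive-≋ xs≋) (↭-shift us qs)

  -- Adding an accessible element x to an accessible multiset xs: by induction
  -- on x and, within it, on xs. Depending on whether a step replaces x or an
  -- element of xs, the result is xs with smaller elements added one by one, or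
  -- x added to a multiset below xs.
  mutual

    ∷-accessible : ∀ {x xs} → Acc _<_ x → Acc _≺_ xs → Acc _≺_ (x ∷ xs)
    ∷-accessible x-acc xs-acc = acc (below-∷ x-acc xs-acc)

    below-∷ : ∀ {x xs ys} → Acc _<_ x → Acc _≺_ xs → ys ≺ (x ∷ xs) → Acc _≺_ ys
    below-∷ x-acc xs-acc (replace y zs ws p q ws<y) =
      Acc-resp-↭ (↭-sym q) (replaced-accessible ws x-acc xs-acc ws<y (∷-↭-∷ p))

    replaced-accessible : ∀ {x y xs zs} ws → Acc _<_ x → Acc _≺_ xs → All (_< y) ws →
                          (x ≈ y × xs ↭ zs) ⊎ (∃ λ us → xs ↭ y ∷ us × zs ↭ x ∷ us) →
                          Acc _≺_ (ws ++ zs)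
    replaced-accessible [] _ xs-acc [] (inj₁ (_ , xs↭zs)) = Acc-resp-↭ xs↭zs xs-acc
    replaced-accessible (w ∷ ws) x-acc@(acc rx) xs-acc (w<y ∷ ws<y) (inj₁ (x≈y , xs↭zs)) =
      ∷-accessible (rx (<-respʳ (≈-sym x≈y) w<y))
        (replaced-accessible ws x-acc xs-acc ws<y (inj₁ (x≈y , xs↭zs)))
    replaced-accessible ws x-acc (acc rxs) ws<y (inj₂ (us , xs↭ , zs↭)) =
      Acc-resp-↭ (↭-sym (↭-trans (++⁺ˡ ws zs↭) (↭-shift ws us)))
        (∷-accessible x-acc (rxs (replace _ us ws xs↭ ↭-refl ws<y)))

  accessible : ∀ {xs} → All (Acc _<_) xs → Acc _≺_ xs
  accessible [] = acc λ { (replace _ _ _ []↭ _ _) → contradiction (↭-sym []↭) ¬x∷xs↭[] }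
  accessible (x-acc ∷ xs-acc) = ∷-accessible x-acc (accessible xs-acc)

-- Exchanging arguments

-- Closure under contexts, one argument position at a time.
data Closure {Γ : Set a} {X : Set b} (R : Rel (Term Γ X) ℓ) : Rel (Term Γ X) (a ⊔ b ⊔ ℓ) where
  root : ∀ {s t} → R s t → Closure R s t
  arg  : ∀ h us vs {s t} → Closure R s t →
         Closure R (fun h (us ++ s ∷ vs)) (fun h (us ++ t ∷ vs))

-- The swap of two adjacent arguments at the root, for arbitrary argument
-- terms: unlike Swap, it does not ask for a supply of distinct variables.
data Exchange {Γ : Set a} {X : Set b} : Rel (Term Γ X) (a ⊔ b) where
  exchange : ∀ h us {s t} vs → Exchange (fun h (us ++ s ∷ t ∷ vs)) (fun h (us ++ t ∷ s ∷ vs))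

-- Equality up to exchanging arguments anywhere in a term.
infix 4 _≈_

_≈_ : {Γ : Set a} {X : Set b} → Rel (Term Γ X) (a ⊔ b)
_≈_ = EqClosure (Closure Exchange)

module _ {Γ : Set a} {X : Set b} where

  ≈-setoid : Setoid _ _
  ≈-setoid = setoid (Closure (Exchange {Γ = Γ} {X = X}))

  open Setoid ≈-setoid public using () renaming (sym to ≈-sym)
  open Permutation ≈-setoid public
    using (_↭_; ↭-refl; ↭-sym; ↭-trans; ↭-swap; prep)
  open PermutationProperties ≈-setoid public using (++⁺ˡ; All-resp-↭)

  Exchange-sym : {s t : Term Γ X} → Exchange s t → Exchange t s
  Exchange-sym (exchange h us vs) = exchange h us vs

  Closure-Exchange-sym : {s t : Term Γ X} → Closure Exchange s t → Closure Exchange t s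
  Closure-Exchange-sym (root s~t)        = root (Exchange-sym s~t)
  Closure-Exchange-sym (arg h us vs s~t) = arg h us vs (Closure-Exchange-sym s~t)

  fun-Exchange-inverse : ∀ {h ts s} → Closure Exchange (fun h ts) s →
                         ∃ λ ss → s ≡ fun h ss × ts ↭ ss
  fun-Exchange-inverse (root (exchange h us vs)) = _ , refl , ++⁺ˡ us (↭-swap _ _ ↭-refl)
  fun-Exchange-inverse (arg h us vs s~t)         = _ , refl , ++⁺ˡ us (prep (fwd s~t ◅ ε) ↭-refl)

  -- Here the permutation is itself up to _≈_ of the arguments.
  fun-≈-inverse : ∀ {h ts s} → fun h ts ≈ s → ∃ λ ss → s ≡ fun h ss × ts ↭ ss
  fun-≈-inverse ε = _ , refl , ↭-refl
  fun-≈-inverse (fwd p ◅ ps) with fun-Exchange-inverse p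
  ... | _ , refl , ts↭ with fun-≈-inverse ps
  ...   | _ , refl , ↭ss = _ , refl , ↭-trans ts↭ ↭ss
  fun-≈-inverse (bwd p ◅ ps) with fun-Exchange-inverse (Closure-Exchange-sym p)
  ... | _ , refl , ts↭ with fun-≈-inverse ps
  ...   | _ , refl , ↭ss = _ , refl , ↭-trans ts↭ ↭ss

-- Rewriting with fuelled stars

-- Symbols whose stars carry an amount of fuel.
data Fuelled (F : Set a) : Set a where
  plain   : F → Fuelled F
  starred : ℕ → F → Fuelled F

module _ {F : Set a} {X : Set b} (_>_ : Rel F ℓ) where

  -- The rules of Star with fuel, already instantiated.
  data Contract : Rel (Term (Fuelled F) X) (a ⊔ b ⊔ ℓ) where
    put    : ∀ f n ts → Contract (fun (plain f) ts) (fun (starred n f) ts)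
    select : ∀ f n us t vs → Contract (fun (starred (suc n) f) (us ++ t ∷ vs)) t
    copy   : ∀ f g n ts (m : ℕ) → f > g →
             Contract (fun (starred (suc n) f) ts)
                      (fun (plain g) (replicate m (fun (starred n f) ts)))
    down   : ∀ f g n us ts vs (m : ℕ) →
             Contract (fun (starred (suc n) f) (us ++ fun (plain g) ts ∷ vs))
                      (fun (plain f) (us ++ replicate m (fun (starred n g) ts) ++ vs))

  infix 4 _⟶_ _◁_

  _⟶_ : Rel (Term (Fuelled F) X) _
  _⟶_ = Closure Contract

  -- Reduction modulo exchanges: t ◁ s if some term equal to s up to exchanges
  -- steps to t. Exchanges are not needed after the step: those on the side of s
  -- suffice to make accessibility invariant under exchanges.
  data _◁_ (t s : Term (Fuelled F) X) : Set (a ⊔ b ⊔ ℓ) where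
    reduct : ∀ {s'} → s ≈ s' → s' ⟶ t → t ◁ s

  ◁-respʳ-≈ : _◁_ Respectsʳ _≈_
  ◁-respʳ-≈ s≈t (reduct s≈s' s'⟶r) = reduct (≈-sym s≈t ◅◅ s≈s') s'⟶r

  ⟶⇒◁ : ∀ {s t} → s ⟶ t → t ◁ s
  ⟶⇒◁ = reduct ε

  ⟶⁺⇒◁⁺ : ∀ {r s t} → r ≈ s → TransClosure _⟶_ s t → TransClosure _◁_ t r
  ⟶⁺⇒◁⁺ r≈s [ s⟶t ]      = [ reduct r≈s s⟶t ]
  ⟶⁺⇒◁⁺ r≈s (s⟶u ∷ u⟶⁺t) = ⟶⁺⇒◁⁺ ε u⟶⁺t ∷ʳ reduct r≈s s⟶u

  Acc-resp-≈ : ∀ {s t} → s ≈ t → Acc _◁_ s → Acc _◁_ t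
  Acc-resp-≈ s≈t (acc rs) = acc λ r◁t → rs (◁-respʳ-≈ (≈-sym s≈t) r◁t)

  -- Termination modulo exchanges

  open MultisetExtension ≈-setoid _◁_ ◁-respʳ-≈

  middle-accessible : ∀ us {s t vs} → (Acc _◁_ s → Acc _◁_ t) →
                      All (Acc _◁_) (us ++ s ∷ vs) → All (Acc _◁_) (us ++ t ∷ vs)
  middle-accessible us s⇒t us-s-vs with All.++⁻ us us-s-vs
  ... | us-acc , s-acc ∷ vs-acc = All.++⁺ us-acc (s⇒t s-acc ∷ vs-acc)

  -- The induction is lexicographic: on f, then on the multiset ts, then on the
  -- label, plain coming above all starred n. The list us of actual arguments is
  -- only a permutation of ts: exchanges rearrange the arguments without any
  -- decrease, so the recursion is on the fixed representative ts.
  mutual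

    plain-accessible : ∀ {f ts} us → Acc (flip _>_) f → Acc _≺_ ts → ts ↭ us →
                       All (Acc _◁_) us → Acc _◁_ (fun (plain f) us)
    plain-accessible us f-acc ts-acc ts↭us us-acc =
      acc (below-plain f-acc ts-acc ts↭us us-acc)

    plain-of-accessible : ∀ {f ts} → Acc (flip _>_) f → All (Acc _◁_) ts → Acc _◁_ (fun (plain f) ts)
    plain-of-accessible f-acc ts-acc = plain-accessible _ f-acc (accessible ts-acc) ↭-refl ts-acc

    below-plain : ∀ {f ts us r} → Acc (flip _>_) f → Acc _≺_ ts → ts ↭ us →
                  All (Acc _◁_) us → r ◁ fun (plain f) us → Acc _◁_ r
    below-plain f-acc ts-acc ts↭us us-acc (reduct p q) with fun-≈-inverse p
    ... | vs , refl , us↭vs =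
      plain-step f-acc ts-acc (↭-trans ts↭us us↭vs) (All-resp-↭ Acc-resp-≈ us↭vs us-acc) q

    plain-step : ∀ {f ts us r} → Acc (flip _>_) f → Acc _≺_ ts → ts ↭ us →
                 All (Acc _◁_) us → fun (plain f) us ⟶ r → Acc _◁_ r
    plain-step f-acc ts-acc ts↭us us-acc (root (put f n us)) =
      starred-accessible n us f-acc ts-acc ts↭us us-acc
    plain-step f-acc (acc rts) ts↭us us-acc (arg _ us vs {t = t} s⟶t) =
      plain-accessible _ f-acc
        (rts (≺-respʳ-↭ (↭-sym ts↭us) (replace-within us vs (t ∷ []) (⟶⇒◁ s⟶t ∷ []))))
        ↭-refl (middle-accessible us (λ s-acc → acc-inverse s-acc (⟶⇒◁ s⟶t)) us-acc)

    starred-accessible : ∀ {f ts} n us → Acc (flip _>_) f → Acc _≺_ ts → ts ↭ us →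
                         All (Acc _◁_) us → Acc _◁_ (fun (starred n f) us)
    starred-accessible n us f-acc ts-acc ts↭us us-acc =
      acc (below-starred n f-acc ts-acc ts↭us us-acc)

    below-starred : ∀ {f ts us r} n → Acc (flip _>_) f → Acc _≺_ ts → ts ↭ us →
                    All (Acc _◁_) us → r ◁ fun (starred n f) us → Acc _◁_ r
    below-starred n f-acc ts-acc ts↭us us-acc (reduct p q) with fun-≈-inverse p
    ... | vs , refl , us↭vs =
      starred-step n f-acc ts-acc (↭-trans ts↭us us↭vs) (All-resp-↭ Acc-resp-≈ us↭vs us-acc) q

    starred-step : ∀ {f ts us r} n → Acc (flip _>_) f → Acc _≺_ ts → ts ↭ us →
                   All (Acc _◁_) us → fun (starred n f) us ⟶ r → Acc _◁_ r
    starred-step (suc n) _ _ _ us-acc (root (select f n us t vs))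
      with t-acc ∷ _ ← All.++⁻ʳ us us-acc = t-acc
    starred-step (suc n) (acc rf) ts-acc ts↭us us-acc (root (copy f g n us m f>g)) =
      plain-of-accessible (rf f>g)
        (All.replicate⁺ m (starred-accessible n us (acc rf) ts-acc ts↭us us-acc))
    -- Each copy introduced by down is a put-reduct of the argument it replaces.
    starred-step (suc n) f-acc (acc rts) ts↭us us-acc (root (down f g n us ws vs m))
      with us'-acc , g-acc ∷ vs-acc ← All.++⁻ us us-acc =
      plain-accessible _ f-acc
        (rts (≺-respʳ-↭ (↭-sym ts↭us)
               (replace-within us vs _ (All.replicate⁺ m (⟶⇒◁ (root (put g n ws)))))))
        ↭-refl
        (All.++⁺ us'-acc
          (All.++⁺ (All.replicate⁺ m (acc-inverse g-acc (⟶⇒◁ (root (put g n ws))))) vs-acc))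
    starred-step n f-acc (acc rts) ts↭us us-acc (arg _ us vs {t = t} s⟶t) =
      starred-accessible n _ f-acc
        (rts (≺-respʳ-↭ (↭-sym ts↭us) (replace-within us vs (t ∷ []) (⟶⇒◁ s⟶t ∷ []))))
        ↭-refl (middle-accessible us (λ s-acc → acc-inverse s-acc (⟶⇒◁ s⟶t)) us-acc)

  module _ (>-wf : WellFounded (flip _>_)) where

    mutual

      ◁-wellFounded : WellFounded _◁_
      ◁-wellFounded (var x) = acc λ { (reduct p q) → var-irreducible p q }
        where
        var-irreducible : ∀ {s t} → var x ≈ s → s ⟶ t → Acc _◁_ t
        var-irreducible ε            (root ())
        var-irreducible (fwd (root ()) ◅ _) _
        var-irreducible (bwd (root ()) ◅ _) _
      ◁-wellFounded (fun (plain f) ts) =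
        plain-of-accessible (>-wf f) (all-accessible ts)
      ◁-wellFounded (fun (starred n f) ts) =
        starred-accessible n ts (>-wf f) (accessible (all-accessible ts)) ↭-refl (all-accessible ts)

      all-accessible : ∀ ts → All (Acc _◁_) ts
      all-accessible []       = []
      all-accessible (t ∷ ts) = ◁-wellFounded t ∷ all-accessible ts

-- Equipping stars with fuel

Pointwise-++⁻ : {R : REL A B r} → ∀ xs {ys zs} → Pointwise R (xs ++ ys) zs →
                ∃₂ λ us vs → zs ≡ us ++ vs × Pointwise R xs us × Pointwise R ys vs
Pointwise-++⁻ []       rs       = [] , _ , refl , [] , rs
Pointwise-++⁻ (x ∷ xs) (r ∷ rs) with Pointwise-++⁻ xs rs
... | us , vs , refl , us-rs , vs-rs = _ ∷ us , vs , refl , r ∷ us-rs , vs-rs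

module _ {Γ : Set a} {X : Set b} (σ : X → Term Γ X) where

  substs-++ : ∀ us vs → substs σ (us ++ vs) ≡ substs σ us ++ substs σ vs
  substs-++ []       vs = refl
  substs-++ (u ∷ us) vs = cong (subst σ u ∷_) (substs-++ us vs)

  substs-replicate : ∀ n t → substs σ (replicate n t) ≡ replicate n (subst σ t)
  substs-replicate zero    t = refl
  substs-replicate (suc n) t = cong (subst σ t ∷_) (substs-replicate n t)

-- The second symbol is the first one, with at least k units of fuel on a star.
data FuelledSymbol {F : Set a} (k : ℕ) : WithStars F → Fuelled F → Set a where
  plain   : ∀ f → FuelledSymbol k (plain f) (plain f)
  starred : ∀ f {n} → k ≤ n → FuelledSymbol k (starred f) (starred n f)

-- The second term is the first one, with at least k units of fuel on every star.
data Lifts {F : Set a} {X : Set b} (k : ℕ) :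
           Term (WithStars F) X → Term (Fuelled F) X → Set (a ⊔ b) where
  var : ∀ x → Lifts k (var x) (var x)
  fun : ∀ {h h' ts ts'} → FuelledSymbol k h h' → Pointwise (Lifts k) ts ts' →
        Lifts k (fun h ts) (fun h' ts')

FuelledSymbol-anti : ∀ {k k'} {h : WithStars F} {h'} → k' ≤ k →
                     FuelledSymbol k h h' → FuelledSymbol k' h h'
FuelledSymbol-anti k'≤k (plain f)       = plain f
FuelledSymbol-anti k'≤k (starred f k≤n) = starred f (≤-trans k'≤k k≤n)

mutual

  Lifts-anti : ∀ {k k'} {t : Term (WithStars F) X} {t'} → k' ≤ k →
               Lifts k t t' → Lifts k' t t'
  Lifts-anti k'≤k (var x)    = var x
  Lifts-anti k'≤k (fun h ts) = fun (FuelledSymbol-anti k'≤k h) (Lifts-anti* k'≤k ts)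

  Lifts-anti* : ∀ {k k'} {ts : List (Term (WithStars F) X)} {ts'} → k' ≤ k →
                Pointwise (Lifts k) ts ts' → Pointwise (Lifts k') ts ts'
  Lifts-anti* k'≤k []       = []
  Lifts-anti* k'≤k (t ∷ ts) = Lifts-anti k'≤k t ∷ Lifts-anti* k'≤k ts

mutual

  -- The fuelled counterpart of a star-free term.
  fuelled : Term F X → Term (Fuelled F) X
  fuelled (var x)    = var x
  fuelled (fun f ts) = fun (plain f) (fuelleds ts)

  fuelleds : List (Term F X) → List (Term (Fuelled F) X)
  fuelleds []       = []
  fuelleds (t ∷ ts) = fuelled t ∷ fuelleds ts

mutual

  embed-lifts : ∀ {k} (t : Term F X) → Lifts k (embed t) (fuelled t)
  embed-lifts (var x)    = var x
  embed-lifts (fun f ts) = fun (plain f) (embeds-lift ts)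

  embeds-lift : ∀ {k} (ts : List (Term F X)) → Pointwise (Lifts k) (embeds ts) (fuelleds ts)
  embeds-lift []       = []
  embeds-lift (t ∷ ts) = embed-lifts t ∷ embeds-lift ts

mutual

  embed-lift-unique : ∀ {k} (t : Term F X) {t'} → Lifts k (embed t) t' → t' ≡ fuelled t
  embed-lift-unique (var x)    (var x)          = refl
  embed-lift-unique (fun f ts) (fun (plain f) r) = cong (fun (plain f)) (embeds-lift-unique ts r)

  embeds-lift-unique : ∀ {k} (ts : List (Term F X)) {ts'} →
                       Pointwise (Lifts k) (embeds ts) ts' → ts' ≡ fuelleds ts
  embeds-lift-unique []       []       = refl
  embeds-lift-unique (t ∷ ts) (r ∷ rs) = cong₂ _∷_ (embed-lift-unique t r) (embeds-lift-unique ts rs)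

-- Simulation by fuelled terms

-- Any lift of s with fuel k is related by Q to some lift of t with fuel k'.
Simulated : {F : Set a} {X : Set b} (k k' : ℕ) (Q : Rel (Term (Fuelled F) X) ℓ) →
            Rel (Term (WithStars F) X) _
Simulated k k' Q s t = ∀ {s'} → Lifts k s s' → ∃ λ t' → Q s' t' × Lifts k' t t'

-- It suffices to simulate the instances of the rules. The stars outside the
-- redex keep their fuel, so nothing is lost there when k' ≤ k.
Rewrite-simulated : ∀ {F : Set a} {X : Set b} {k k'}
  {R : TRS (WithStars F) X ℓ} {Q : Rel (Term (Fuelled F) X) ℓ'} → k' ≤ k →
  (∀ σ {l r} → R l r → Simulated k k' Q (subst σ l) (subst σ r)) →
  ∀ {s t} → Rewrite R s t → Simulated k k' (Closure Q) s t
Rewrite-simulated {k = k} {k'} {Q = Q} k'≤k rule-simulated (step C σ {l} {r} l⇒r) = go C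
  where
  go : ∀ C → Simulated k k' (Closure Q) (plug C (subst σ l)) (plug C (subst σ r))
  go hole lift with rule-simulated σ l⇒r lift
  ... | t' , s'Qt' , t-lift = t' , root s'Qt' , t-lift
  go (fun h us C vs) (fun h-lift ts-lift) with Pointwise-++⁻ us ts-lift
  ... | us' , s' ∷ vs' , refl , us-lift , s-lift ∷ vs-lift with go C s-lift
  ...   | t' , s'⟶t' , t-lift =
    _ , arg _ us' vs' s'⟶t' ,
    fun (FuelledSymbol-anti k'≤k h-lift)
      (Pointwise.++⁺ (Lifts-anti* k'≤k us-lift) (t-lift ∷ Lifts-anti* k'≤k vs-lift))

Swap⇒Exchange : {Γ : Set a} {X : Set b} (σ : X → Term Γ X) → ∀ {l r} →
                Swap l r → Exchange (subst σ l) (subst σ r)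
Swap⇒Exchange σ (swap f us x y ws _)
  rewrite substs-++ σ (vars us) (var x ∷ var y ∷ vars ws)
        | substs-++ σ (vars us) (var y ∷ var x ∷ vars ws) = exchange f _ _

Exchange-simulated : ∀ {k} {s t : Term (WithStars F) X} → Exchange s t →
                     Simulated k k Exchange s t
Exchange-simulated (exchange h us vs) (fun h-lift ts-lift) with Pointwise-++⁻ us ts-lift
... | us' , _ ∷ _ ∷ vs' , refl , us-lift , s-lift ∷ t-lift ∷ vs-lift =
  _ , exchange _ us' vs' , fun h-lift (Pointwise.++⁺ us-lift (t-lift ∷ s-lift ∷ vs-lift))

≃-simulated : ∀ {k} {s t : Term (WithStars F) X} → s ≃ t → Simulated k k _≈_ s t
≃-simulated ε lift = _ , ε , lift
≃-simulated (fwd p ◅ ps) lift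
  with Rewrite-simulated ≤-refl (λ σ q → Exchange-simulated (Swap⇒Exchange σ q)) p lift
... | _ , q , lift' with ≃-simulated ps lift'
...   | _ , qs , lift'' = _ , fwd q ◅ qs , lift''
-- A backward step is a forward step of the system with reversed rules.
≃-simulated (bwd (step C σ p) ◅ ps) lift
  with Rewrite-simulated {R = flip Swap} ≤-refl
         (λ σ q → Exchange-simulated (Exchange-sym (Swap⇒Exchange σ q))) (step C σ p) lift
... | _ , q , lift' with ≃-simulated ps lift'
...   | _ , qs , lift'' = _ , fwd q ◅ qs , lift''

module _ {F : Set a} {X : Set b} (_>_ : Rel F ℓ) where

  Star-simulated : ∀ {k} (σ : X → Term (WithStars F) X) {l r} → Star _>_ l r →
                   Simulated (suc k) k (Contract _>_) (subst σ l) (subst σ r)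
  -- The new star gets just the fuel k required afterwards.
  Star-simulated σ (put f xs _) (fun (plain f) ts-lift) =
    _ , put f _ _ , fun (starred f ≤-refl) (Lifts-anti* (n≤1+n _) ts-lift)
  Star-simulated σ (select f xs y zs _) (fun (starred f (s≤s k≤n)) ts-lift)
    rewrite substs-++ σ (vars xs) (var y ∷ vars zs)
    with Pointwise-++⁻ (substs σ (vars xs)) ts-lift
  ... | us' , t' ∷ vs' , refl , _ , t-lift ∷ _ = t' , select f _ us' t' vs' , Lifts-anti (n≤1+n _) t-lift
  Star-simulated σ (copy f g xs n _ f>g) (fun (starred f (s≤s k≤n)) ts-lift)
    rewrite substs-replicate σ n (fun (starred f) (vars xs)) =
    _ , copy f g _ _ n f>g ,
    fun (plain g) (Pointwise.replicate⁺ (fun (starred f k≤n) (Lifts-anti* (n≤1+n _) ts-lift)) n)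
  Star-simulated σ (down f g xs ys zs n _) (fun (starred f (s≤s k≤n)) ts-lift)
    rewrite substs-++ σ (vars xs) (fun (plain g) (vars ys) ∷ vars zs)
          | substs-++ σ (vars xs) (replicate n (fun (starred g) (vars ys)) ++ vars zs)
          | substs-++ σ (replicate n (fun (starred g) (vars ys))) (vars zs)
          | substs-replicate σ n (fun (starred g) (vars ys))
    with Pointwise-++⁻ (substs σ (vars xs)) ts-lift
  ... | us' , fun _ ts' ∷ vs' , refl , us-lift , fun (plain g) ys-lift ∷ vs-lift =
    _ , down f g _ us' ts' vs' n ,
    fun (plain f)
      (Pointwise.++⁺ (Lifts-anti* (n≤1+n _) us-lift)
        (Pointwise.++⁺ (Pointwise.replicate⁺ (fun (starred g k≤n) (Lifts-anti* (n≤1+n _) ys-lift)) n)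
          (Lifts-anti* (n≤1+n _) vs-lift)))

  ⇝-simulated : ∀ {k} {s t : Term (WithStars F) X} → Rewrite (Star _>_) s t →
                Simulated (suc k) k (_⟶_ _>_) s t
  ⇝-simulated = Rewrite-simulated (n≤1+n _) Star-simulated

  -- The initial fuel is the number of steps.
  Star⁺-simulated : ∀ {s t : Term (WithStars F) X} → TransClosure (Rewrite (Star _>_)) s t →
                    ∃ λ k → Simulated k 0 (TransClosure (_⟶_ _>_)) s t
  Star⁺-simulated [ s⇝t ] = 1 , λ lift →
    let t' , s'⟶t' , t-lift = ⇝-simulated s⇝t lift
    in t' , [ s'⟶t' ] , t-lift
  Star⁺-simulated (s⇝u ∷ u⇝⁺t) with Star⁺-simulated u⇝⁺t
  ... | k , u⇝⁺t-simulated = suc k , λ lift →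
    let _  , s'⟶u' , u-lift  = ⇝-simulated s⇝u lift
        t' , u'⟶⁺t' , t-lift = u⇝⁺t-simulated u-lift
    in t' , s'⟶u' ∷ u'⟶⁺t' , t-lift

lemma4p18 : {a b ℓ : Level} (F : Set a) (X : Set b) → Infinite X →
    (_>_ : Rel F ℓ) → IsStrictPartialOrder _≡_ _>_ → WellFounded (flip _>_) →
    ¬ (∃ λ (t : Term F X) → ∃ λ (t' : Term (WithStars F) X) →
    TransClosure (Rewrite (Star _>_)) (embed t) t' × t' ≃ embed t)
lemma4p18 F X _ _>_ _ >-wf (t , t' , t⇝⁺t' , t'≃t) with Star⁺-simulated _>_ t⇝⁺t'
... | k , sim with sim (embed-lifts t)
...   | s , t⟶⁺s , s-lift with ≃-simulated t'≃t s-lift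
...     | u , s≈u , u-lift with refl ← embed-lift-unique t u-lift =
  wf⇒asym (Trans.wellFounded _ (◁-wellFounded _>_ >-wf)) s◁⁺s s◁⁺s
  where
  s◁⁺s = ⟶⁺⇒◁⁺ _>_ s≈u t⟶⁺s
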